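{- Let $n\ge 1$. For a noncrossing partition $\pi$ of $[n]$ let $s(\pi)$ be its number of singleton blocks and $a(\pi)$ its number of adjacencies. Then: (1) On the set of noncrossing partitions of $[n]$ the statistics $s$ and $a$ have a symmetric joint distribution: for all integers $p,q\ge 0$, the number of noncrossing partitions $\pi$ of $[n]$ with $(s(\pi),a(\pi))=(p,q)$ equals the number with $(s(\pi),a(\pi))=(q,p)$. In particular $s$ and $a$ have the same distribution. (2) The same holds on the set of rotation classes of noncrossing partitions of $[n]$ (on which $s$ and $a$ are well defined, being constant on each rotation class): for all $p,q\ge 0$, the number of rotation classes with $(s,a)=(p,q)$ equals the number with $(s,a)=(q,p)$.
   Context: Write $[n]=\{1,2,\dots,n\}$. A partition of $[n]$ is noncrossing if no quadruple $a<b<c<d$ has $a,c$ in one block and $b,d$ in a different block. The rotation operator $R$ on partitions of $[n]$ is induced by the map $i\mapsto i+1\pmod n$ on $[n]$; it preserves the noncrossing property. The rotation class of $\pi$ is $\{R^i(\pi): i\ge 1\}$. An adjacency of $\pi$ is an occurrence of two consecutive elements of $[n]$ in the same block, where consecutive is taken in the circular sense ($n$ and $1$ are considered consecutive); that is, adjacencies are counted by the $i\in[n]$ such that $i$ and $i+1 \pmod n$ lie in the same block. (With this convention, for $n=1$ the unique partition has one adjacency, and for $n=2$ the one-block partition has two adjacencies.) -}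

module Defs where

open import Data.Bool using (Bool; T; T?)
open import Data.Fin using (Fin; toℕ; _<_)
open import Data.Fin.Properties using (toℕ<n; toℕ-injective; toℕ-fromℕ<)
open import Data.Fin.Subset using (Subset; _∈_; Nonempty; ⁅_⁆)
open import Data.Fin.Subset.Properties using (_∈?_; anySubset?)
open import Data.Nat using (ℕ; suc; _+_; _%_; _≥_)
open import Data.Nat.DivMod using (_mod_; m%n<n; %-distribˡ-+; m%n%n≡m%n; [m+n]%n≡m%n; m<n⇒m%n≡m)
open import Data.Nat.GeneralisedArithmetic using (iterate)
open import Data.Nat.Properties using (+-comm; +-suc)
open import Data.Product using (∃-syntax; Σ-syntax; _×_; _,_; proj₁)
open import Data.Vec using (lookup; tabulate; count; allFin)
open import Data.Vec.Properties
  using (lookup∘tabulate; tabulate∘lookup; tabulate-cong; lookup⇒[]=; []=⇒lookup)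
open import Function using (_∘_; _⇔_; mk⇔; Inverse; Equivalence)
open import Level using (0ℓ)
open import Relation.Binary using (Setoid)
import Relation.Binary.Construct.On as On
open import Relation.Binary.PropositionalEquality
  using (_≡_; _≢_; refl; sym; trans; cong; subst; setoid; module ≡-Reasoning)
open import Relation.Nullary using (¬_; Dec)
open import Relation.Nullary.Decidable using (_×-dec_)

-- [n] is represented by Fin n, with 1, …, n relabelled 0, …, n-1.

private
  variable
    n : ℕ

next : Fin n → Fin n
next {suc m} i = suc (toℕ i) mod suc m

prev : Fin n → Fin n
prev {suc m} i = (m + toℕ i) mod suc m

private
  toℕ-mod : ∀ k m → toℕ (k mod suc m) ≡ k % suc m
  toℕ-mod k m = toℕ-fromℕ< (m%n<n k (suc m))

  +-%-absorb : ∀ j k m → (j + k % suc m) % suc m ≡ (j + k) % suc m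
  +-%-absorb j k m = begin
    (j + k % suc m) % suc m                      ≡⟨ %-distribˡ-+ j (k % suc m) (suc m) ⟩
    (j % suc m + k % suc m % suc m) % suc m      ≡⟨ cong (λ x → (j % suc m + x) % suc m) (m%n%n≡m%n k (suc m)) ⟩
    (j % suc m + k % suc m) % suc m              ≡⟨ %-distribˡ-+ j k (suc m) ⟨
    (j + k) % suc m                              ∎
    where open ≡-Reasoning

  full-turn : ∀ {m} (i : Fin (suc m)) → (suc m + toℕ i) % suc m ≡ toℕ i
  full-turn {m} i = begin
    (suc m + toℕ i) % suc m  ≡⟨ cong (_% suc m) (+-comm (suc m) (toℕ i)) ⟩
    (toℕ i + suc m) % suc m  ≡⟨ [m+n]%n≡m%n (toℕ i) (suc m) ⟩
    toℕ i % suc m            ≡⟨ m<n⇒m%n≡m (toℕ<n i) ⟩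
    toℕ i                    ∎
    where open ≡-Reasoning

next-prev : (i : Fin n) → next (prev i) ≡ i
next-prev {suc m} i = toℕ-injective (begin
  toℕ (next (prev i))                    ≡⟨ toℕ-mod (suc (toℕ (prev i))) m ⟩
  (1 + toℕ (prev i)) % suc m             ≡⟨ cong (λ x → (1 + x) % suc m) (toℕ-mod (m + toℕ i) m) ⟩
  (1 + (m + toℕ i) % suc m) % suc m      ≡⟨ +-%-absorb 1 (m + toℕ i) m ⟩
  (suc m + toℕ i) % suc m                ≡⟨ full-turn i ⟩
  toℕ i                                  ∎)
  where open ≡-Reasoning

prev-next : (i : Fin n) → prev (next i) ≡ i
prev-next {suc m} i = toℕ-injective (begin
  toℕ (prev (next i))                    ≡⟨ toℕ-mod (m + toℕ (next i)) m ⟩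
  (m + toℕ (next i)) % suc m             ≡⟨ cong (λ x → (m + x) % suc m) (toℕ-mod (suc (toℕ i)) m) ⟩
  (m + suc (toℕ i) % suc m) % suc m      ≡⟨ +-%-absorb m (suc (toℕ i)) m ⟩
  (m + suc (toℕ i)) % suc m              ≡⟨ cong (_% suc m) (+-suc m (toℕ i)) ⟩
  (suc m + toℕ i) % suc m                ≡⟨ full-turn i ⟩
  toℕ i                                  ∎)
  where open ≡-Reasoning

-- A finite set of blocks is given by its Boolean indicator on Subset n.
record Partition (n : ℕ) : Set where
  field
    isBlock : Subset n → Bool

  Block : Subset n → Set
  Block B = T (isBlock B)

  field
    nonempty : ∀ {B} → Block B → Nonempty B
    cover    : ∀ i → ∃[ B ] (Block B × i ∈ B)
    disjoint : ∀ {B C i} → Block B → Block C → i ∈ B → i ∈ C → B ≡ C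

open Partition public using (isBlock; Block)

partitions : ℕ → Setoid 0ℓ 0ℓ
partitions n = record
  { Carrier       = Partition n
  ; _≈_           = λ π ρ → ∀ B → isBlock π B ≡ isBlock ρ B
  ; isEquivalence = record
    { refl  = λ _ → refl
    ; sym   = λ e B → sym (e B)
    ; trans = λ e f B → trans (e B) (f B)
    }
  }

infix 4 _≈ₚ_
_≈ₚ_ : Partition n → Partition n → Set
_≈ₚ_ {n} = Setoid._≈_ (partitions n)

Crossing : Partition n → Set
Crossing {n} π =
  Σ[ a ∈ Fin n ] Σ[ b ∈ Fin n ] Σ[ c ∈ Fin n ] Σ[ d ∈ Fin n ]
    (a < b × b < c × c < d ×
     (∃[ B ] ∃[ C ] (Block π B × Block π C × B ≢ C × a ∈ B × c ∈ B × b ∈ C × d ∈ C)))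

Noncrossing : Partition n → Set
Noncrossing π = ¬ Crossing π

SameBlock : Partition n → Fin n → Fin n → Set
SameBlock π i j = ∃[ B ] (Block π B × i ∈ B × j ∈ B)

sameBlock? : (π : Partition n) (i j : Fin n) → Dec (SameBlock π i j)
sameBlock? π i j = anySubset? (λ B → T? (isBlock π B) ×-dec (i ∈? B ×-dec j ∈? B))

-- The singleton subsets of [n] are exactly the ⁅ i ⁆, one for each i.
singletons : Partition n → ℕ
singletons {n} π = count (λ i → T? (isBlock π ⁅ i ⁆)) (allFin n)

adjacencies : Partition n → ℕ
adjacencies {n} π = count (λ i → sameBlock? π i (next i)) (allFin n)

preimage : (Fin n → Fin n) → Subset n → Subset n
preimage f B = tabulate (lookup B ∘ f)

private
  ∈-preimage : ∀ {f : Fin n → Fin n} {B i} → i ∈ preimage f B ⇔ f i ∈ B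
  ∈-preimage {f = f} {B} {i} = mk⇔
    (λ p → lookup⇒[]= (f i) B (trans (sym (lookup∘tabulate (lookup B ∘ f) i)) ([]=⇒lookup p)))
    (λ p → lookup⇒[]= i _ (trans (lookup∘tabulate (lookup B ∘ f) i) ([]=⇒lookup p)))

  preimage-inverse : ∀ {f g : Fin n → Fin n} → (∀ i → f (g i) ≡ i) →
                     ∀ B → preimage g (preimage f B) ≡ B
  preimage-inverse {f = f} {g} fg B = trans
    (tabulate-cong (λ i → trans (lookup∘tabulate (lookup B ∘ f) (g i)) (cong (lookup B) (fg i))))
    (tabulate∘lookup B)

-- The blocks of R π are the images under next of the blocks of π; as next is
-- a bijection, B is such an image iff its preimage under next is a block of π.
rotate : Partition n → Partition n
rotate π = record
  { isBlock  = isBlock π ∘ preimage next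
  ; nonempty = λ b → let (i , p) = nonempty b in next i , Equivalence.to ∈-preimage p
  ; cover    = λ i → let (C , b , p) = cover (prev i) in
      preimage prev C
      , subst (Block π) (sym (preimage-inverse prev-next C)) b
      , Equivalence.from ∈-preimage p
  ; disjoint = λ {B} {C} {i} b c p q →
      trans (sym (preimage-inverse next-prev B))
        (trans (cong (preimage prev) (disjoint b c (back B p) (back C q)))
               (preimage-inverse next-prev C))
  }
  where
  open Partition π using (nonempty; cover; disjoint)

  back : ∀ B {i} → i ∈ B → prev i ∈ preimage next B
  back B {i} p = Equivalence.from ∈-preimage (subst (_∈ B) (sym (next-prev i)) p)

-- RotationClass π is the set { Rⁱ π : i ≥ 1 }, as a predicate on partitions.
RotationClass : Partition n → Partition n → Set
RotationClass π σ = ∃[ i ] (i ≥ 1 × iterate rotate π i ≈ₚ σ)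

infix 4 _≈ᵣ_
_≈ᵣ_ : Partition n → Partition n → Set
π ≈ᵣ ρ = ∀ σ → RotationClass π σ ⇔ RotationClass ρ σ

rotationClasses : ℕ → Setoid 0ℓ 0ℓ
rotationClasses n = record
  { Carrier       = Partition n
  ; _≈_           = _≈ᵣ_
  ; isEquivalence = record
    { refl  = λ _ → mk⇔ (λ x → x) (λ x → x)
    ; sym   = λ e σ → mk⇔ (Equivalence.from (e σ)) (Equivalence.to (e σ))
    ; trans = λ e f σ → mk⇔ (Equivalence.to (f σ) ∘ Equivalence.to (e σ))
                            (Equivalence.from (e σ) ∘ Equivalence.from (f σ))
    }
  }

NCPartitions : (n : ℕ) → (Partition n → Set) → Setoid 0ℓ 0ℓ
NCPartitions n P = On.setoid {B = Σ[ π ∈ Partition n ] (Noncrossing π × P π)} (partitions n) proj₁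

-- A class is given by any representative; representatives with equal classes
-- are identified.
NCRotationClasses : (n : ℕ) → (Partition n → Set) → Setoid 0ℓ 0ℓ
NCRotationClasses n P = On.setoid {B = Σ[ π ∈ Partition n ] (Noncrossing π × P π)} (rotationClasses n) proj₁

HasCardinality : Setoid 0ℓ 0ℓ → ℕ → Set
HasCardinality S N = Inverse S (setoid (Fin N))

SameNumber : Setoid 0ℓ 0ℓ → Setoid 0ℓ 0ℓ → Set
SameNumber S S′ = ∃[ N ] (HasCardinality S N × HasCardinality S′ N)

{-# OPTIONS --safe #-}
module Submission where

-- Kreweras complement: put a point a′ just after each a on the circle, and let a′ and b′ be
-- in one block of the complement iff no chord joining two points of a block of π separates them.  The relation "the chords ij and a′b′ do not cross" is, up to
-- a shift by one place, symmetric in its two chords; so, once π is known to be recovered from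
-- its complement by the dual construction (where noncrossingness enters), the square of the
-- complement is the inverse rotation, and the complement commutes with rotation.  The point i′
-- is isolated exactly when i and i+1 share a block, so singletons and adjacencies are swapped.

open import Defs
open import Data.Bool as 𝔹 using (Bool; true; false; not; T; T?; _xor_; if_then_else_; f≤t; b≤b)
import Data.Bool.Properties as Bool
open import Data.Bool.Solver using (module xor-∧-Solver)
open import Data.Fin as Fin using (Fin; zero; suc; toℕ; finToFun; funToFin)
open import Data.Fin.Permutation using (permutation)
open import Data.Fin.Properties
  using (toℕ-fromℕ<; toℕ-injective; toℕ<n; any?; all?; finToFun-funToFin; ≡-isDecEquivalence; _<?_)
open import Data.Fin.Subset using (Subset; _∈_; ⁅_⁆)
open import Data.Fin.Subset.Properties
  using (_∈?_; anySubset?; ⊆-antisym; x∈⁅x⁆; x∈⁅y⁆⇒x≡y)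
open import Data.List as List using (List; []; _∷_; deduplicate)
open import Data.List.Membership.Propositional.Properties using (∈-lookup)
import Data.List.Relation.Unary.All as All
open import Data.List.Relation.Unary.AllPairs using (AllPairs; []; _∷_)
open import Data.List.Relation.Unary.Any as Any using (Any; here; there)
open import Data.List.Relation.Unary.Any.Properties using (lookup-index; tabulate⁺)
open import Data.List.Relation.Unary.Enumerates.Setoid using (IsEnumeration)
open import Data.List.Relation.Unary.Enumerates.Setoid.Properties using (deduplicate⁺)
open import Data.List.Relation.Unary.Unique.DecSetoid.Properties using (deduplicate-!)
open import Data.Nat as ℕ
  using (ℕ; zero; suc; _+_; _*_; _^_; _%_; _/_; _≤_; _≥_; _≤?_; z≤n; s≤s)
open import Data.Nat.DivMod
  using (m%n<n; m<n⇒m%n≡m; n%n≡0; %-distribˡ-+; m%n%n≡m%n; [m+n]%n≡m%n; m≡m%n+[m/n]*n)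
open import Data.Nat.GeneralisedArithmetic using (iterate)
open import Data.Nat.Properties
  using ( ≤-trans; ≤-antisym; ≤-pred; <-cmp; <⇒≤; <⇒≱; ≮⇒≥; ≰⇒>; ≤∧≢⇒<; m≤n⇒m<n∨m≡n
        ; m≤n⇒m≤o+n; +-suc; +-identityʳ; *-suc; +-0-commutativeMonoid)
open import Data.Product using (Σ; Σ-syntax; ∃-syntax; _×_; _,_; proj₁; proj₂; swap)
open import Data.Sum using (inj₁; inj₂)
open import Data.Vec using (Vec; []; _∷_; lookup; tabulate; count; allFin)
open import Data.Vec.Properties using (≡-dec; lookup∘tabulate; lookup⇒[]=; []=⇒lookup)
open import Function using (_∘_; id; _⇔_; mk⇔; Inverse; Equivalence)
open import Function.Construct.Composition using (inverse)
open import Level using (0ℓ)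
open import Relation.Binary using (IsDecEquivalence; Setoid; DecSetoid; tri<; tri≈; tri>)
import Relation.Binary.Construct.On as On
open import Relation.Binary.PropositionalEquality
  using (_≡_; refl; sym; trans; cong; cong₂; subst; subst₂; module ≡-Reasoning)
import Relation.Binary.Reasoning.Setoid as SetoidReasoning
open import Relation.Nullary using (¬_; Dec; yes; no; does; contradiction)
open import Relation.Nullary.Decidable
  using ( ⌊_⌋; toWitness; fromWitness; map′; _×-dec_; _→-dec_; ¬?; does-⇔; decidable-stable
        ; dec-true; dec-false)
open import Relation.Unary using (Decidable)
open import Algebra.Properties.CommutativeMonoid.Sum +-0-commutativeMonoid using (sum; sum-permute)

private
  variable
    n : ℕ

open Equivalence using (to; from)

-- Partitions and their equivalence relations

module _ (π : Partition n) where
  open Partition π using (cover; disjoint)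

  sameBlock-refl : ∀ i → SameBlock π i i
  sameBlock-refl i = let (B , b , p) = cover i in B , b , p , p

  sameBlock-sym : ∀ {i j} → SameBlock π i j → SameBlock π j i
  sameBlock-sym (B , b , p , q) = B , b , q , p

  block-closed : ∀ {B i j} → Block π B → i ∈ B → SameBlock π i j → j ∈ B
  block-closed b p (C , c , q , r) = subst (_ ∈_) (disjoint c b q p) r

  sameBlock-trans : ∀ {i j k} → SameBlock π i j → SameBlock π j k → SameBlock π i k
  sameBlock-trans (B , b , p , q) s = B , b , p , block-closed b q s

infix 4 _⊑_
_⊑_ : Partition n → Partition n → Set
π ⊑ ρ = ∀ {i j} → SameBlock π i j → SameBlock ρ i j

≈ₚ⇒⊑ : {π ρ : Partition n} → π ≈ₚ ρ → π ⊑ ρ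
≈ₚ⇒⊑ e (B , b , p , q) = B , subst T (e B) b , p , q

-- Blocks are nonempty, so each block of one partition shares a point with some block of the other,
-- and the two inclusions force these blocks to have the same members. Equalities of partitions can
-- therefore be proved on `SameBlock` alone.
⊑-antisym : (π ρ : Partition n) → π ⊑ ρ → ρ ⊑ π → π ≈ₚ ρ
⊑-antisym π ρ f g B =
  Bool.⇔→≡ (mk⇔ (to Bool.T-≡ ∘ half π ρ f g ∘ from Bool.T-≡)
                 (to Bool.T-≡ ∘ half ρ π g f ∘ from Bool.T-≡))
  where
  half : ∀ σ τ → σ ⊑ τ → τ ⊑ σ → Block σ B → Block τ B
  half σ τ f g b =
    let (i , p)     = Partition.nonempty σ b
        (C , c , q) = Partition.cover τ i
    in subst (Block τ)
         (⊆-antisym (λ r → block-closed σ b p (g (C , c , q , r)))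
                    (λ r → block-closed τ c q (f (B , b , p , r))))
         c

module _ {_~_ : Fin n → Fin n → Set} (~-isDec : IsDecEquivalence _~_) where
  private
    module ~ = IsDecEquivalence ~-isDec

    class : Fin n → Subset n
    class i = tabulate (λ j → does (i ~.≟ j))

    ∈-class⁺ : ∀ {i j} → i ~ j → j ∈ class i
    ∈-class⁺ {i} {j} r = lookup⇒[]= j _ (trans (lookup∘tabulate _ j) (dec-true (i ~.≟ j) r))

    ∈-class⁻ : ∀ {i j} → j ∈ class i → i ~ j
    ∈-class⁻ {i} {j} p with i ~.≟ j | trans (sym (lookup∘tabulate (λ j → does (i ~.≟ j)) j)) ([]=⇒lookup p)
    ... | yes r | _ = r

    isClass? : ∀ B → Dec (∃[ i ] B ≡ class i)
    isClass? B = any? (λ i → ≡-dec Bool._≟_ B (class i))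

  abstract
    fromEquivalence : Partition n
    fromEquivalence = record
      { isBlock  = λ B → ⌊ isClass? B ⌋
      ; nonempty = λ {B} b → let (i , e) = toWitness {a? = isClass? B} b in
          i , subst (i ∈_) (sym e) (∈-class⁺ ~.refl)
      ; cover    = λ i → class i , fromWitness {a? = isClass? _} (i , refl) , ∈-class⁺ ~.refl
      ; disjoint = λ {B} {C} {k} b c p q →
          let (i , e) = toWitness {a? = isClass? B} b
              (j , f) = toWitness {a? = isClass? C} c
              r       = ∈-class⁻ (subst (k ∈_) e p)
              s       = ∈-class⁻ (subst (k ∈_) f q)
          in trans e (trans
               (⊆-antisym (λ t → ∈-class⁺ (~.trans (~.trans s (~.sym r)) (∈-class⁻ t)))
                          (λ t → ∈-class⁺ (~.trans (~.trans r (~.sym s)) (∈-class⁻ t))))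
               (sym f))
      }

    sameBlock-fromEquivalence : ∀ {i j} → SameBlock fromEquivalence i j ⇔ i ~ j
    sameBlock-fromEquivalence {i} {j} = mk⇔
      (λ (B , b , p , q) → let (k , e) = toWitness {a? = isClass? B} b in
        ~.trans (~.sym (∈-class⁻ (subst (i ∈_) e p))) (∈-class⁻ (subst (j ∈_) e q)))
      (λ r → class i , fromWitness {a? = isClass? _} (i , refl) , ∈-class⁺ ~.refl , ∈-class⁺ r)

-- Moves the singleton condition, defined on subsets, to the relation `SameBlock`, in which rotation
-- and complement are described.
singleton⇔ : (π : Partition n) (i : Fin n) → Block π ⁅ i ⁆ ⇔ (∀ j → SameBlock π i j → j ≡ i)
singleton⇔ π i = mk⇔
  (λ b j s → x∈⁅y⁆⇒x≡y i (block-closed π b (x∈⁅x⁆ i) s))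
  (λ h → let (B , b , p) = Partition.cover π i in
    subst (Block π)
      (⊆-antisym (λ {j} q → subst (_∈ ⁅ i ⁆) (sym (h j (B , b , p , q))) (x∈⁅x⁆ i))
                 (λ q → subst (_∈ B) (sym (x∈⁅y⁆⇒x≡y i q)) p))
      b)

-- Rotation

-- As `next` is onto, a relation may be checked at shifted points, where `sameBlock-rotate` and the
-- chord lemmas apply.
∀-next : {Q : Fin n → Fin n → Set} → (∀ i j → Q (next i) (next j)) → ∀ i j → Q i j
∀-next {Q = Q} h i j = subst₂ Q (next-prev i) (next-prev j) (h (prev i) (prev j))

sameBlock-rotate : (π : Partition n) → ∀ {i j} → SameBlock (rotate π) (next i) (next j) ⇔ SameBlock π i j
sameBlock-rotate π {i} {j} = mk⇔
  (λ (B , b , p , q) → preimage next B , b , pull p , pull q)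
  (λ s → let (B , b , p) = Partition.cover (rotate π) (next i) in
    B , b , p , push (block-closed π b (pull p) s))
  where
  pull : ∀ {B i} → next i ∈ B → i ∈ preimage next B
  pull {i = i} p = lookup⇒[]= i _ (trans (lookup∘tabulate _ i) ([]=⇒lookup p))

  push : ∀ {B i} → i ∈ preimage next B → next i ∈ B
  push {B} {i} p = lookup⇒[]= (next i) B (trans (sym (lookup∘tabulate _ i)) ([]=⇒lookup p))

≈ₚ-by-next : (π ρ : Partition n) →
             (∀ {i j} → SameBlock π (next i) (next j) ⇔ SameBlock ρ (next i) (next j)) → π ≈ₚ ρ
≈ₚ-by-next π ρ h = ⊑-antisym π ρ
  (λ {i} {j} → ∀-next {Q = λ i j → SameBlock π i j → SameBlock ρ i j} (λ _ _ → to h) i j)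
  (λ {i} {j} → ∀-next {Q = λ i j → SameBlock ρ i j → SameBlock π i j} (λ _ _ → from h) i j)

toℕ-iterate-next : ∀ {m} (i : Fin (suc m)) k → toℕ (iterate next i k) ≡ (toℕ i + k) % suc m
toℕ-iterate-next {m} i zero =
  sym (trans (cong (_% suc m) (+-identityʳ (toℕ i))) (m<n⇒m%n≡m (toℕ<n i)))
toℕ-iterate-next {m} i (suc k) = begin
  toℕ (iterate next (next i) k)                     ≡⟨ toℕ-iterate-next (next i) k ⟩
  (toℕ (next i) + k) % suc m                        ≡⟨ cong (λ x → (x + k) % suc m) (toℕ-fromℕ< (m%n<n (suc (toℕ i)) (suc m))) ⟩
  (suc (toℕ i) % suc m + k) % suc m                 ≡⟨ %-distribˡ-+ (suc (toℕ i) % suc m) k (suc m) ⟩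
  (suc (toℕ i) % suc m % suc m + k % suc m) % suc m ≡⟨ cong (λ x → (x + k % suc m) % suc m) (m%n%n≡m%n (suc (toℕ i)) (suc m)) ⟩
  (suc (toℕ i) % suc m + k % suc m) % suc m         ≡⟨ %-distribˡ-+ (suc (toℕ i)) k (suc m) ⟨
  (suc (toℕ i) + k) % suc m                         ≡⟨ cong (_% suc m) (+-suc (toℕ i) k) ⟨
  (toℕ i + suc k) % suc m                           ∎
  where open ≡-Reasoning

iterate-next-period : (i : Fin n) → iterate next i n ≡ i
iterate-next-period {suc m} i = toℕ-injective
  (trans (toℕ-iterate-next i (suc m))
    (trans ([m+n]%n≡m%n (toℕ i) (suc m)) (m<n⇒m%n≡m (toℕ<n i))))

module ≈ₚ-Reasoning {n : ℕ} = SetoidReasoning (partitions n)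

sameBlock-iterate : ∀ k (π : Partition n) {i j} →
  SameBlock (iterate rotate π k) (iterate next i k) (iterate next j k) ⇔ SameBlock π i j
sameBlock-iterate zero    π = mk⇔ id id
sameBlock-iterate (suc k) π = mk⇔
  (to (sameBlock-rotate π) ∘ to (sameBlock-iterate k (rotate π)))
  (from (sameBlock-iterate k (rotate π)) ∘ from (sameBlock-rotate π))

rotate-period : (π : Partition n) → iterate rotate π n ≈ₚ π
rotate-period {n} π = ⊑-antisym (iterate rotate π n) π
  (λ {i} {j} s → to (sameBlock-iterate n π)
    (subst₂ (SameBlock (iterate rotate π n)) (sym (iterate-next-period i)) (sym (iterate-next-period j)) s))
  (λ {i} {j} s → subst₂ (SameBlock (iterate rotate π n)) (iterate-next-period i) (iterate-next-period j)
    (from (sameBlock-iterate n π) s))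

rotate-cong : (π ρ : Partition n) → π ≈ₚ ρ → rotate π ≈ₚ rotate ρ
rotate-cong π ρ e B = e (preimage next B)

iterate-cong : ∀ k {π ρ : Partition n} → π ≈ₚ ρ → iterate rotate π k ≈ₚ iterate rotate ρ k
iterate-cong zero    e = e
iterate-cong (suc k) {π} {ρ} e = iterate-cong k (rotate-cong π ρ e)

iterate-+ : {A : Set} (f : A → A) (x : A) (k l : ℕ) → iterate f x (k + l) ≡ iterate f (iterate f x k) l
iterate-+ f x zero    l = refl
iterate-+ f x (suc k) l = iterate-+ f (f x) k l

iterate-comm : {A : Set} (f : A → A) (x : A) (k : ℕ) → iterate f (f x) k ≡ f (iterate f x k)
iterate-comm f x zero    = refl
iterate-comm f x (suc k) = iterate-comm f (f x) k

-- The Kreweras complement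

χ : Fin n → Fin n → Bool
χ i a = does (toℕ i ≤? toℕ a)

-- The primed point a′ lies just after a, so that χ i a tells whether i precedes a′;
-- the chords i j and a′ b′ do not cross iff a′ and b′ are on the same side of i j.
Parallel : Fin n → Fin n → Fin n → Fin n → Set
Parallel i j a b = (χ i a xor χ j a) ≡ (χ i b xor χ j b)

-- Both equations say that the xor of the four bits is `false`. The second groups them by unprimed
-- endpoint: each side tells whether that endpoint lies between a′ and b′.
parallel-swap : ∀ {i j a b : Fin n} → Parallel i j a b ⇔ ((χ i a xor χ i b) ≡ (χ j a xor χ j b))
parallel-swap {i = i} {j} {a} {b} =
  mk⇔ (transpose (χ i a) (χ j a) (χ i b) (χ j b)) (transpose (χ i a) (χ i b) (χ j a) (χ j b))
  where
  transpose : ∀ p q r s → (p xor q) ≡ (r xor s) → (p xor r) ≡ (q xor s)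
  transpose false false false false _ = refl
  transpose false false true  true  _ = refl
  transpose false true  false true  _ = refl
  transpose false true  true  false _ = refl
  transpose true  false false true  _ = refl
  transpose true  false true  false _ = refl
  transpose true  true  false false _ = refl
  transpose true  true  true  true  _ = refl

isNotLast : Fin n → Bool
isNotLast {n} i = does (suc (suc (toℕ i)) ≤? n)

does-complement : {A B : Set} (a? : Dec A) (b? : Dec B) → (A → ¬ B) → (¬ B → A) → does a? ≡ not (does b?)
does-complement a? (yes b) f g = dec-false a? (λ a → f a b)
does-complement a? (no ¬b) f g = dec-true a? (g ¬b)

-- If `i` is not last, `next i` is its successor, which is at most `a` exactly when `a` is not at
-- most `i`. If `i` is last, `next i` is the first point and both comparisons hold. The correcting
-- bit depends on `i` only.
χ-next : (i a : Fin n) → χ (next i) a ≡ isNotLast i xor χ a i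
χ-next {suc m} i a = helper (suc (suc (toℕ i)) ≤? suc m)
  where
  helper : (d : Dec (suc (suc (toℕ i)) ≤ suc m)) → χ (next i) a ≡ does d xor χ a i
  helper (yes p) = trans
    (cong (λ x → does (x ≤? toℕ a)) (trans (toℕ-fromℕ< _) (m<n⇒m%n≡m p)))
    (does-complement (suc (toℕ i) ≤? toℕ a) (toℕ a ≤? toℕ i) <⇒≱ ≰⇒>)
  helper (no ¬p) = trans
    (cong (λ x → does (x ≤? toℕ a))
      (trans (toℕ-fromℕ< _) (trans (cong (λ x → suc x % suc m) i≡m) (n%n≡0 (suc m)))))
    (sym (dec-true (toℕ a ≤? toℕ i) (subst (toℕ a ≤_) (sym i≡m) (≤-pred (toℕ<n a)))))
    where
    i≡m : toℕ i ≡ m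
    i≡m = ≤-antisym (≤-pred (toℕ<n i)) (≤-pred (≤-pred (≰⇒> ¬p)))

xor-cancelˡ : ∀ c {x y} → (c xor x) ≡ (c xor y) → x ≡ y
xor-cancelˡ false e = e
xor-cancelˡ true  e = Bool.not-injective e

xor-interchange : ∀ p q r s → ((p xor q) xor (r xor s)) ≡ ((p xor r) xor (q xor s))
xor-interchange = solve 4 (λ p q r s → ((p :+ q) :+ (r :+ s)) := ((p :+ r) :+ (q :+ s))) refl
  where open xor-∧-Solver

χ-next₂ : (i j a : Fin n) →
  (χ (next i) a xor χ (next j) a) ≡ ((isNotLast i xor isNotLast j) xor (χ a i xor χ a j))
χ-next₂ i j a = trans (cong₂ _xor_ (χ-next i a) (χ-next j a))
  (xor-interchange (isNotLast i) (χ a i) (isNotLast j) (χ a j))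

-- Shifting `i` and `j` exchanges the arguments of `χ`, up to bits that depend on `i` and `j` alone.
-- These bits are the same on both sides of the equation and cancel, which leaves the two chords
-- with their roles exchanged.
parallel-flip : ∀ {i j a b : Fin n} → Parallel (next i) (next j) a b ⇔ Parallel a b i j
parallel-flip {i = i} {j} {a} {b} = mk⇔
  (λ h → from (parallel-swap {i = a} {b})
    (xor-cancelˡ (isNotLast i xor isNotLast j) (trans (sym (χ-next₂ i j a)) (trans h (χ-next₂ i j b)))))
  (λ h → trans (χ-next₂ i j a) (trans
    (cong ((isNotLast i xor isNotLast j) xor_) (to (parallel-swap {i = a} {b}) h))
    (sym (χ-next₂ i j b))))

-- Each flip shifts one chord and exchanges the roles; two flips shift both chords and restore the
-- roles.
parallel-next : ∀ {i j a b : Fin n} → Parallel (next i) (next j) (next a) (next b) ⇔ Parallel i j a b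
parallel-next {i = i} {j} {a} {b} = mk⇔
  (to (parallel-flip {i = a} {b}) ∘ to (parallel-flip {i = i} {j}))
  (from (parallel-flip {i = i} {j}) ∘ from (parallel-flip {i = a} {b}))

KrewerasRel : Partition n → Fin n → Fin n → Set
KrewerasRel π a b = ∀ i j → SameBlock π i j → Parallel i j a b

krewerasRel-isDecEquivalence : (π : Partition n) → IsDecEquivalence (KrewerasRel π)
krewerasRel-isDecEquivalence π = record
  { isEquivalence = record
    { refl  = λ _ _ _ → refl
    ; sym   = λ h i j s → sym (h i j s)
    ; trans = λ h k i j s → trans (h i j s) (k i j s)
    }
  ; _≟_ = λ a b → all? (λ i → all? (λ j → sameBlock? π i j →-dec
      ((χ i a xor χ j a) Bool.≟ (χ i b xor χ j b))))
  }

abstract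
  kreweras : Partition n → Partition n
  kreweras π = fromEquivalence (krewerasRel-isDecEquivalence π)

  sameBlock-kreweras : (π : Partition n) → ∀ {a b} → SameBlock (kreweras π) a b ⇔ KrewerasRel π a b
  sameBlock-kreweras π = sameBlock-fromEquivalence (krewerasRel-isDecEquivalence π)

kreweras-⊑ : {π ρ : Partition n} → π ⊑ ρ → kreweras ρ ⊑ kreweras π
kreweras-⊑ {π = π} {ρ} f s =
  from (sameBlock-kreweras π) (λ i j t → to (sameBlock-kreweras ρ) s i j (f t))

kreweras-cong : (π ρ : Partition n) → π ≈ₚ ρ → kreweras π ≈ₚ kreweras ρ
kreweras-cong π ρ e = ⊑-antisym (kreweras π) (kreweras ρ)
  (kreweras-⊑ {π = ρ} {π} (≈ₚ⇒⊑ {π = ρ} {π} (sym ∘ e)))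
  (kreweras-⊑ {π = π} {ρ} (≈ₚ⇒⊑ {π = π} {ρ} e))

kreweras-rotate : (π : Partition n) → kreweras (rotate π) ≈ₚ rotate (kreweras π)
kreweras-rotate π = ≈ₚ-by-next (kreweras (rotate π)) (rotate (kreweras π)) (λ {a} {b} → mk⇔
  (λ s → from (sameBlock-rotate (kreweras π)) (from (sameBlock-kreweras π)
    (λ i j t → to (parallel-next {i = i} {j})
      (to (sameBlock-kreweras (rotate π)) s (next i) (next j) (from (sameBlock-rotate π) t)))))
  (λ s → from (sameBlock-kreweras (rotate π))
    (∀-next {Q = λ i j → SameBlock (rotate π) i j → Parallel i j (next a) (next b)}
      (λ i j t → from (parallel-next {i = i} {j})
        (to (sameBlock-kreweras π) (to (sameBlock-rotate (kreweras π)) s) i j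
          (to (sameBlock-rotate π) t))))))

-- A monotone sequence of bits jumps at most once. If exactly one of the two sequences jumped at the
-- first step, the first equation would make the other jump at the second step; no jump would be
-- left for the third step, against the second equation.
monotone-xor : ∀ {p₁ p₂ p₃ p₄ q₁ q₂ q₃ q₄} →
  p₁ 𝔹.≤ p₂ → p₂ 𝔹.≤ p₃ → p₃ 𝔹.≤ p₄ → q₁ 𝔹.≤ q₂ → q₂ 𝔹.≤ q₃ → q₃ 𝔹.≤ q₄ →
  (p₁ xor q₁) ≡ (p₃ xor q₃) → (p₂ xor q₂) ≡ (p₄ xor q₄) → (p₁ xor q₁) ≡ (p₂ xor q₂)
monotone-xor b≤b _   _   b≤b _   _   _ _  = refl
monotone-xor f≤t b≤b b≤b f≤t b≤b b≤b _ _  = refl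
monotone-xor f≤t b≤b b≤b b≤b f≤t b≤b _ ()
monotone-xor f≤t b≤b b≤b b≤b b≤b f≤t () _
monotone-xor {q₁ = false} f≤t b≤b b≤b b≤b b≤b b≤b () _
monotone-xor {q₁ = true}  f≤t b≤b b≤b b≤b b≤b b≤b () _
monotone-xor b≤b f≤t b≤b f≤t b≤b b≤b _ ()
monotone-xor b≤b b≤b f≤t f≤t b≤b b≤b () _
monotone-xor {p₁ = false} b≤b b≤b b≤b f≤t b≤b b≤b () _
monotone-xor {p₁ = true}  b≤b b≤b b≤b f≤t b≤b b≤b () _

does-mono : {A B : Set} (a? : Dec A) (b? : Dec B) → (A → B) → does a? 𝔹.≤ does b?
does-mono (yes a) b? f = subst (true 𝔹.≤_) (sym (dec-true b? (f a))) b≤b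
does-mono (no _)  b? f = Bool.≤-minimum (does b?)

χ-mono : ∀ (i : Fin n) {a b} → a Fin.< b → χ i a 𝔹.≤ χ i b
χ-mono i {a} {b} a<b = does-mono (toℕ i ≤? toℕ a) (toℕ i ≤? toℕ b) (λ i≤a → ≤-trans i≤a (<⇒≤ a<b))

-- A crossing would make a ↦ χ i a xor χ j a change three times, but it changes at most twice.
kreweras-noncrossing : (π : Partition n) → Noncrossing (kreweras π)
kreweras-noncrossing π (a , b , c , d , a<b , b<c , c<d , B , C , bB , bC , B≢C , a∈B , c∈B , b∈C , d∈C) =
  B≢C (Partition.disjoint (kreweras π) bB bC (block-closed (kreweras π) bB a∈B a~b) b∈C)
  where
  a~b : SameBlock (kreweras π) a b
  a~b = from (sameBlock-kreweras π) (λ i j s → monotone-xor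
    (χ-mono i a<b) (χ-mono i b<c) (χ-mono i c<d) (χ-mono j a<b) (χ-mono j b<c) (χ-mono j c<d)
    (to (sameBlock-kreweras π) (B , bB , a∈B , c∈B) i j s)
    (to (sameBlock-kreweras π) (C , bC , b∈C , d∈C) i j s))

-- Recovering a noncrossing partition from its complement

module _ (π : Partition n) (nc : Noncrossing π) where

  -- The positive form of noncrossing: equality of the two blocks is decidable, and distinct blocks
  -- would give a crossing.
  noncrossing-sameBlock : ∀ {a b c d} → a Fin.< b → b Fin.< c → c Fin.< d →
    SameBlock π a c → SameBlock π b d → SameBlock π a b
  noncrossing-sameBlock a<b b<c c<d (B , bB , a∈B , c∈B) (C , bC , b∈C , d∈C)
    with ≡-dec Bool._≟_ B C
  ... | yes refl = B , bB , a∈B , b∈C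
  ... | no B≢C   = contradiction
    (_ , _ , _ , _ , a<b , b<c , c<d , B , C , bB , bC , B≢C , a∈B , c∈B , b∈C , d∈C) nc

least : {P : Fin n → Set} → Decidable P → ∃[ i ] P i → ∃[ w ] (P w × (∀ i → P i → w Fin.≤ i))
least {suc n} {P} P? (i , p) with P? zero
... | yes p₀ = zero , p₀ , λ _ _ → z≤n
... | no ¬p₀ =
  let (w , pw , h) = least (P? ∘ suc) (above i p)
  in suc w , pw , λ { zero p₀ → contradiction p₀ ¬p₀ ; (suc j) q → s≤s (h j q) }
  where
  above : ∀ i → P i → ∃[ j ] P (suc j)
  above zero    p₀ = contradiction p₀ ¬p₀
  above (suc j) q  = j , q

greatest : {P : Fin n → Set} → Decidable P → ∃[ i ] P i → ∃[ u ] (P u × (∀ i → P i → i Fin.≤ u))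
greatest {suc n} P? (i , p) with any? (P? ∘ suc)
... | yes q =
  let (u , pu , h) = greatest (P? ∘ suc) q
  in suc u , pu , λ { zero _ → z≤n ; (suc j) q → s≤s (h j q) }
greatest {suc n} P? (zero  , p) | no ¬q =
  zero , p , λ { zero _ → z≤n ; (suc j) q → contradiction (j , q) ¬q }
greatest {suc n} P? (suc i , p) | no ¬q = contradiction (i , p) ¬q

Inside : Fin n → Fin n → Fin n → Set
Inside w u x = w Fin.≤ x × x Fin.≤ u

-- When `w` is at most `u`, at least one of the two comparisons holds, so the xor is `true` exactly
-- off the interval [w, u].
outside : Fin n → Fin n → Fin n → Bool
outside w u x = χ w x xor χ x u

inside⇔ : ∀ {w u x : Fin n} → w Fin.≤ u → outside w u x ≡ false ⇔ Inside w u x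
inside⇔ {w = w} {u} {x} w≤u = mk⇔ (both (toℕ w ≤? toℕ x) (toℕ x ≤? toℕ u))
  (λ (p , q) → cong₂ _xor_ (dec-true (toℕ w ≤? toℕ x) p) (dec-true (toℕ x ≤? toℕ u) q))
  where
  both : (p? : Dec (w Fin.≤ x)) (q? : Dec (x Fin.≤ u)) → does p? xor does q? ≡ false → Inside w u x
  both (yes p) (yes q) _ = p , q
  both (no ¬p) (no ¬q) _ = contradiction (≤-trans (<⇒≤ (≰⇒> ¬p)) w≤u) ¬q

-- The left side records the side of `x` relative to the chord between (w-1)′ and u′. With `w`
-- written as `next (prev w)`, `χ-next` exchanges the arguments of `χ w x` at the cost of a bit
-- independent of `x`; this bit also handles the case where `w` is the first point and `prev w` the
-- last.
outside-chord : ∀ (w u x : Fin n) → (χ x (prev w) xor χ x u) ≡ (isNotLast (prev w) xor outside w u x)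
outside-chord w u x = begin
  χ x (prev w) xor χ x u                   ≡⟨ cancel ℓ (χ x (prev w)) (χ x u) ⟩
  ℓ xor ((ℓ xor χ x (prev w)) xor χ x u)   ≡⟨ cong (λ b → ℓ xor (b xor χ x u)) (χ-next (prev w) x) ⟨
  ℓ xor (χ (next (prev w)) x xor χ x u)    ≡⟨ cong (λ v → ℓ xor (χ v x xor χ x u)) (next-prev w) ⟩
  ℓ xor outside w u x                      ∎
  where
  open ≡-Reasoning
  ℓ = isNotLast (prev w)
  cancel : ∀ c p q → (p xor q) ≡ (c xor ((c xor p) xor q))
  cancel false p q = refl
  cancel true false q = sym (Bool.not-involutive q)
  cancel true true  q = refl

parallel-chord : ∀ {i j w u : Fin n} → Parallel i j (prev w) u ⇔ outside w u i ≡ outside w u j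
parallel-chord {i = i} {j} {w} {u} = mk⇔
  (λ h → xor-cancelˡ (isNotLast (prev w))
    (trans (sym (outside-chord w u i)) (trans (to (parallel-swap {i = i} {j}) h) (outside-chord w u j))))
  (λ h → from (parallel-swap {i = i} {j})
    (trans (outside-chord w u i) (trans (cong (isNotLast (prev w) xor_) h) (sym (outside-chord w u j)))))

-- The dual construction, leading from a partition of the primed points back to a relation on the
-- unprimed ones.
CoKrewerasRel : Partition n → Fin n → Fin n → Set
CoKrewerasRel ρ i j = ∀ a b → SameBlock ρ a b → Parallel i j a b

module _ (π : Partition n) (nc : Noncrossing π) where
  private
    _~_ = SameBlock π

    -- A point `x` of the hull outside the block of `i` lies strictly between `w` and `u`. If some
    -- `y` in the block of `x` were outside the hull, the chord from `x` to `y` would cross the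
    -- chord from `w` to `u`, and noncrossing would put `x` into the block of `i`.
    hull-saturated : ∀ {i w u} → i ~ w → i ~ u → (∀ x → i ~ x → Inside w u x) →
                     ∀ {x y} → x ~ y → Inside w u x → Inside w u y
    hull-saturated {i} {w} {u} i~w i~u h {x} {y} x~y (w≤x , x≤u) with sameBlock? π i x
    ... | yes i~x = h y (sameBlock-trans π i~x x~y)
    ... | no  i≁x = ≮⇒≥ y≮w , ≮⇒≥ u≮y
      where
      w<x : w Fin.< x
      w<x = ≤∧≢⇒< w≤x (λ e → i≁x (subst (i ~_) (toℕ-injective e) i~w))
      x<u : x Fin.< u
      x<u = ≤∧≢⇒< x≤u (λ e → i≁x (subst (i ~_) (sym (toℕ-injective e)) i~u))
      w~u : w ~ u
      w~u = sameBlock-trans π (sameBlock-sym π i~w) i~u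
      y≮w : ¬ (y Fin.< w)
      y≮w y<w = i≁x (sameBlock-trans π i~w (sameBlock-trans π
        (sameBlock-sym π (noncrossing-sameBlock π nc y<w w<x x<u (sameBlock-sym π x~y) w~u))
        (sameBlock-sym π x~y)))
      u≮y : ¬ (u Fin.< y)
      u≮y u<y = i≁x (sameBlock-trans π i~w (noncrossing-sameBlock π nc w<x x<u u<y w~u x~y))

    -- The convex hull [w, u] of a block is a union of blocks, so (w-1)′ and u′ lie in the
    -- same block of the complement and separate the hull from the other points.
    inside-hull : ∀ {i j} → CoKrewerasRel (kreweras π) i j →
                  ∃[ w ] ∃[ u ] (i ~ w × i ~ u × Inside w u j)
    inside-hull {i} {j} h =
      let (w , i~w , w-least)    = least (sameBlock? π i) (i , sameBlock-refl π i)
          (u , i~u , u-greatest) = greatest (sameBlock? π i) (i , sameBlock-refl π i)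
          bounds                 = λ x i~x → w-least x i~x , u-greatest x i~x
          w≤u                    = w-least u i~u
          saturated              = λ {x} {y} → hull-saturated i~w i~u bounds {x} {y}
          pw~u = from (sameBlock-kreweras π) (λ x y x~y → from (parallel-chord {i = x} {y})
            (Bool.⇔→≡ (mk⇔
              (from (inside⇔ {x = y} w≤u) ∘ saturated x~y ∘ to (inside⇔ {x = x} w≤u))
              (from (inside⇔ {x = x} w≤u) ∘ saturated (sameBlock-sym π x~y) ∘ to (inside⇔ {x = y} w≤u)))))
      in w , u , i~w , i~u ,
         to (inside⇔ w≤u) (trans (sym (to (parallel-chord {i = i} {j}) (h (prev w) u pw~u)))
                                 (from (inside⇔ w≤u) (bounds i (sameBlock-refl π i))))

    -- If both outer inequalities are strict, the chord from `w` to `j` crosses the chord from `i`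
    -- to `u`, so all four points share a block. Equality at either end gives the claim at once.
    between : ∀ {i j w u} → i Fin.< j → j ~ w → i ~ u → w Fin.≤ i → j Fin.≤ u → i ~ j
    between {i} {j} {w} {u} i<j j~w i~u w≤i j≤u with m≤n⇒m<n∨m≡n w≤i | m≤n⇒m<n∨m≡n j≤u
    ... | inj₂ w≡i | _        = subst (_~ j) (toℕ-injective w≡i) (sameBlock-sym π j~w)
    ... | inj₁ _   | inj₂ j≡u = subst (i ~_) (sym (toℕ-injective j≡u)) i~u
    ... | inj₁ w<i | inj₁ j<u = sameBlock-trans π
      (sameBlock-sym π (noncrossing-sameBlock π nc w<i i<j j<u (sameBlock-sym π j~w) i~u))
      (sameBlock-sym π j~w)

    coKreweras-sym : ∀ {i j} → CoKrewerasRel (kreweras π) i j → CoKrewerasRel (kreweras π) j i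
    coKreweras-sym {i} {j} h a b s =
      from (parallel-swap {i = j} {i}) (sym (to (parallel-swap {i = i} {j}) (h a b s)))

  -- By `inside-hull` each of `i` and `j` lies in the hull of the other's block. Their order decides
  -- which hull endpoints go into `between`. The converse is the definition of the complement read
  -- backwards.
  coKreweras-kreweras : ∀ {i j} → CoKrewerasRel (kreweras π) i j ⇔ SameBlock π i j
  coKreweras-kreweras {i} {j} = mk⇔ f (λ s a b t → to (sameBlock-kreweras π) t i j s)
    where
    f : CoKrewerasRel (kreweras π) i j → i ~ j
    f h with <-cmp (toℕ i) (toℕ j) | inside-hull h | inside-hull (coKreweras-sym {i} {j} h)
    ... | tri≈ _ i≡j _ | _ | _ = subst (i ~_) (toℕ-injective i≡j) (sameBlock-refl π i)
    ... | tri< i<j _ _ | _ , _ , _ , i~u , _ , j≤u | _ , _ , j~w , _ , w≤i , _ = between i<j j~w i~u w≤i j≤u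
    ... | tri> _ _ j<i | _ , _ , i~w , _ , w≤j , _ | _ , _ , _ , j~u , _ , i≤u =
      sameBlock-sym π (between j<i i~w j~u w≤j i≤u)

  -- `parallel-flip` turns the relation of the double complement at `i` and `j` into
  -- `CoKrewerasRel (kreweras π)` at `next i` and `next j`, which is the relation of `π` there.
  rotate-kreweras² : rotate (kreweras (kreweras π)) ≈ₚ π
  rotate-kreweras² = ≈ₚ-by-next (rotate (kreweras (kreweras π))) π (λ {i} {j} → mk⇔
    (λ s → to coKreweras-kreweras (λ a b t → from (parallel-flip {i = i} {j})
      (to (sameBlock-kreweras (kreweras π)) (to (sameBlock-rotate (kreweras (kreweras π))) s) a b t)))
    (λ s → from (sameBlock-rotate (kreweras (kreweras π))) (from (sameBlock-kreweras (kreweras π))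
      (λ a b t → to (parallel-flip {i = i} {j}) (from coKreweras-kreweras s a b t)))))

-- Singletons and adjacencies

count-⇔ : {P Q : Fin n → Set} (P? : Decidable P) (Q? : Decidable Q) → (∀ i → P i ⇔ Q i) →
          ∀ {m} (v : Vec (Fin n) m) → count P? v ≡ count Q? v
count-⇔ P? Q? h []      = refl
count-⇔ P? Q? h (i ∷ v) with does (P? i) | does (Q? i) | does-⇔ (h i) (P? i) (Q? i)
... | true  | _ | refl = cong suc (count-⇔ P? Q? h v)
... | false | _ | refl = count-⇔ P? Q? h v

count-tabulate : {A : Set} {P : A → Set} (P? : Decidable P) (f : Fin n → A) →
                 count P? (tabulate f) ≡ sum (λ i → if does (P? (f i)) then 1 else 0)
count-tabulate {zero}  P? f = refl
count-tabulate {suc n} P? f with does (P? (f zero))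
... | true  = cong suc (count-tabulate P? (f ∘ suc))
... | false = count-tabulate P? (f ∘ suc)

count-next : {P : Fin n → Set} (P? : Decidable P) →
             count P? (allFin n) ≡ count (P? ∘ next) (allFin n)
count-next P? = trans (count-tabulate P? id) (trans
  (sum-permute (λ i → if does (P? i) then 1 else 0) (permutation next prev next-prev prev-next))
  (sym (count-tabulate (P? ∘ next) id)))

singleton? : (π : Partition n) → Decidable (λ i → Block π ⁅ i ⁆)
singleton? π i = T? (isBlock π ⁅ i ⁆)

adjacency? : (π : Partition n) → Decidable (λ i → SameBlock π i (next i))
adjacency? π i = sameBlock? π i (next i)

module _ (π ρ : Partition n) (e : π ≈ₚ ρ) where

  singletons-cong : singletons π ≡ singletons ρ
  singletons-cong = count-⇔ (singleton? π) (singleton? ρ)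
    (λ i → mk⇔ (subst T (e ⁅ i ⁆)) (subst T (sym (e ⁅ i ⁆)))) (allFin n)

  adjacencies-cong : adjacencies π ≡ adjacencies ρ
  adjacencies-cong = count-⇔ (adjacency? π) (adjacency? ρ)
    (λ i → mk⇔ (≈ₚ⇒⊑ {π = π} {ρ} e) (≈ₚ⇒⊑ {π = ρ} {π} (sym ∘ e))) (allFin n)

  noncrossing-cong : Noncrossing π → Noncrossing ρ
  noncrossing-cong nc (a , b , c , d , a<b , b<c , c<d , B , C , bB , bC , rest) =
    nc (a , b , c , d , a<b , b<c , c<d , B , C , subst T (sym (e B)) bB , subst T (sym (e C)) bC , rest)

next-injective : {i j : Fin n} → next i ≡ next j → i ≡ j
next-injective {i = i} {j} e = trans (sym (prev-next i)) (trans (cong prev e) (prev-next j))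

singletons-rotate : (π : Partition n) → singletons (rotate π) ≡ singletons π
singletons-rotate {n} π = trans (count-next (singleton? (rotate π))) (count-⇔
  (singleton? (rotate π) ∘ next) (singleton? π) (λ i → mk⇔
  (λ b → from (singleton⇔ π i) (λ j s →
    next-injective (to (singleton⇔ (rotate π) (next i)) b (next j) (from (sameBlock-rotate π) s))))
  (λ b → from (singleton⇔ (rotate π) (next i)) (λ j s →
    trans (sym (next-prev j)) (cong next (to (singleton⇔ π i) b (prev j)
      (to (sameBlock-rotate π) (subst (SameBlock (rotate π) (next i)) (sym (next-prev j)) s)))))))
  (allFin n))

adjacencies-rotate : (π : Partition n) → adjacencies (rotate π) ≡ adjacencies π
adjacencies-rotate {n} π =
  trans (count-next (adjacency? (rotate π)))
        (count-⇔ (adjacency? (rotate π) ∘ next) (adjacency? π) (λ i → sameBlock-rotate π) (allFin n))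

χ-total : (i a : Fin n) → (χ i a xor χ a i) ≡ not (does (i Fin.≟ a))
χ-total i a with i Fin.≟ a
... | yes refl = Bool.xor-same (χ i i)
... | no i≢a   = trans
  (cong (_xor χ a i) (does-complement (toℕ i ≤? toℕ a) (toℕ a ≤? toℕ i)
    (λ p q → i≢a (toℕ-injective (≤-antisym p q))) (<⇒≤ ∘ ≰⇒>)))
  (xor-not-same (χ a i))
  where
  xor-not-same : ∀ b → (not b xor b) ≡ true
  xor-not-same false = refl
  xor-not-same true  = refl

-- As functions of `a`, `χ i` and `χ (next i)` differ only at `i`; when `next` wraps around, they
-- differ everywhere except at `i`.
χ-step : (i a : Fin n) → (χ i a xor χ (next i) a) ≡ (not (isNotLast i) xor does (i Fin.≟ a))
χ-step i a = begin
  χ i a xor χ (next i) a                    ≡⟨ cong (χ i a xor_) (χ-next i a) ⟩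
  χ i a xor (isNotLast i xor χ a i)         ≡⟨ rearrange (isNotLast i) (χ i a) (χ a i) ⟩
  isNotLast i xor (χ i a xor χ a i)         ≡⟨ cong (isNotLast i xor_) (χ-total i a) ⟩
  isNotLast i xor not (does (i Fin.≟ a))    ≡⟨ move-not (isNotLast i) (does (i Fin.≟ a)) ⟩
  not (isNotLast i) xor does (i Fin.≟ a)    ∎
  where
  open ≡-Reasoning
  rearrange : ∀ c p q → (p xor (c xor q)) ≡ (c xor (p xor q))
  rearrange = solve 3 (λ c p q → (p :+ (c :+ q)) := (c :+ (p :+ q))) refl
    where open xor-∧-Solver
  move-not : ∀ p q → (p xor not q) ≡ (not p xor q)
  move-not false q = refl
  move-not true  q = Bool.not-involutive q

-- The chord from i to next i separates i′ from all the other primed points.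
parallel-step : ∀ {i a b : Fin n} → Parallel i (next i) a b ⇔ does (i Fin.≟ a) ≡ does (i Fin.≟ b)
parallel-step {i = i} {a} {b} = mk⇔
  (λ h → xor-cancelˡ (not (isNotLast i)) (trans (sym (χ-step i a)) (trans h (χ-step i b))))
  (λ h → trans (χ-step i a) (trans (cong (not (isNotLast i) xor_) h) (sym (χ-step i b))))

-- Together with `parallel-step`, this shows that when i′ is isolated no chord of the complement
-- crosses the chord from `i` to `next i`.
≟-sameBlock : (ρ : Partition n) {i : Fin n} → (∀ j → SameBlock ρ i j → j ≡ i) →
              ∀ {a b} → SameBlock ρ a b → does (i Fin.≟ a) ≡ does (i Fin.≟ b)
≟-sameBlock ρ {i} h {a} {b} s = does-⇔ (mk⇔
  (λ { refl → sym (h b s) }) (λ { refl → sym (h a (sameBlock-sym ρ s)) })) (i Fin.≟ a) (i Fin.≟ b)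

-- If i′ is isolated, the chord from `i` to `next i` crosses no chord of the complement, so its ends
-- share a block by `coKreweras-kreweras`. Conversely, such a chord in a block cuts i′ off from all
-- other primed points.
singletons-kreweras : (π : Partition n) → Noncrossing π → singletons (kreweras π) ≡ adjacencies π
singletons-kreweras {n} π nc = count-⇔ (singleton? (kreweras π)) (adjacency? π) (λ i → mk⇔
  (λ b → to (coKreweras-kreweras π nc) (λ a c s → from (parallel-step {i = i})
    (≟-sameBlock (kreweras π) (to (singleton⇔ (kreweras π) i) b) s)))
  (λ t → from (singleton⇔ (kreweras π) i) (λ j s → ≟-true (trans
    (sym (to (parallel-step {i = i}) (to (sameBlock-kreweras π) s i (next i) t)))
    (dec-true (i Fin.≟ i) refl)))))
  (allFin n)
  where
  ≟-true : ∀ {i j : Fin n} → does (i Fin.≟ j) ≡ true → j ≡ i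
  ≟-true {i} {j} e with i Fin.≟ j
  ... | yes i≡j = sym i≡j

-- The previous identity, applied to the complement, reduces this to the double complement, which is
-- `π` up to a rotation.
adjacencies-kreweras : (π : Partition n) → Noncrossing π → adjacencies (kreweras π) ≡ singletons π
adjacencies-kreweras π nc = begin
  adjacencies (kreweras π)                      ≡⟨ singletons-kreweras (kreweras π) (kreweras-noncrossing π) ⟨
  singletons (kreweras (kreweras π))            ≡⟨ singletons-rotate (kreweras (kreweras π)) ⟨
  singletons (rotate (kreweras (kreweras π)))   ≡⟨ singletons-cong (rotate (kreweras (kreweras π))) π (rotate-kreweras² π nc) ⟩
  singletons π                                  ∎
  where open ≡-Reasoning

-- Rotation classes

-- Unlike `RotationClass`, this allows zero rotations; for positive `n` the two agree because `n`
-- rotations are the identity.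
Orbit : Partition n → Partition n → Set
Orbit π ρ = ∃[ k ] (iterate rotate π k ≈ₚ ρ)

orbit-refl : (π : Partition n) → Orbit π π
orbit-refl π = 0 , λ _ → refl

orbit-trans : (π ρ σ : Partition n) → Orbit π ρ → Orbit ρ σ → Orbit π σ
orbit-trans π ρ σ (k , e) (l , f) = k + l , (begin
  iterate rotate π (k + l)                 ≡⟨ iterate-+ rotate π k l ⟩
  iterate rotate (iterate rotate π k) l    ≈⟨ iterate-cong l e ⟩
  iterate rotate ρ l                       ≈⟨ f ⟩
  σ                                        ∎)
  where open ≈ₚ-Reasoning

rotate-multiple : ∀ q (π : Partition n) → iterate rotate π (q * n) ≈ₚ π
rotate-multiple     zero    π = λ _ → refl
rotate-multiple {n} (suc q) π = begin
  iterate rotate π (n + q * n)                    ≡⟨ iterate-+ rotate π n (q * n) ⟩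
  iterate rotate (iterate rotate π n) (q * n)     ≈⟨ rotate-multiple q (iterate rotate π n) ⟩
  iterate rotate π n                              ≈⟨ rotate-period π ⟩
  π                                               ∎
  where open ≈ₚ-Reasoning

orbit-sym : ∀ {m} (π ρ : Partition (suc m)) → Orbit π ρ → Orbit ρ π
-- After `k` rotations, `k * m` more complete `k` full turns of length `suc m`.
orbit-sym {m} π ρ (k , e) = k * m , (begin
  iterate rotate ρ (k * m)                       ≈⟨ iterate-cong (k * m) e ⟨
  iterate rotate (iterate rotate π k) (k * m)    ≡⟨ iterate-+ rotate π k (k * m) ⟨
  iterate rotate π (k + k * m)                   ≡⟨ cong (iterate rotate π) (*-suc k m) ⟨
  iterate rotate π (k * suc m)                   ≈⟨ rotate-multiple k π ⟩
  π                                              ∎)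
  where open ≈ₚ-Reasoning

rotationClass⇔orbit : ∀ {m} (π ρ : Partition (suc m)) → RotationClass π ρ ⇔ Orbit π ρ
rotationClass⇔orbit {m} π ρ = mk⇔
  (λ (k , _ , e) → k , e)
  -- A full turn is appended to make the exponent positive.
  (λ (k , e) → let (l , f) = orbit-trans π ρ ρ (k , e) (suc m , rotate-period ρ) in
    l , m≤n⇒m≤o+n k (s≤s z≤n) , f)

≈ᵣ⇔orbit : ∀ {m} (π ρ : Partition (suc m)) → π ≈ᵣ ρ ⇔ Orbit π ρ
≈ᵣ⇔orbit π ρ = mk⇔
  (λ e → to (rotationClass⇔orbit π ρ) (from (e ρ) (from (rotationClass⇔orbit ρ ρ) (orbit-refl ρ))))
  (λ o σ → mk⇔
    (λ c → from (rotationClass⇔orbit ρ σ)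
      (orbit-trans ρ π σ (orbit-sym π ρ o) (to (rotationClass⇔orbit π σ) c)))
    (λ c → from (rotationClass⇔orbit π σ)
      (orbit-trans π ρ σ o (to (rotationClass⇔orbit ρ σ) c))))

_≟ₚ_ : (π ρ : Partition n) → Dec (π ≈ₚ ρ)
π ≟ₚ ρ = map′
  (λ ¬d B → decidable-stable (isBlock π B Bool.≟ isBlock ρ B) (λ d → ¬d (B , d)))
  (λ e (B , d) → d (e B))
  (¬? (anySubset? (λ B → ¬? (isBlock π B Bool.≟ isBlock ρ B))))

-- Exponents matter only modulo the period, so it suffices to try those below `suc m`.
orbit? : ∀ {m} (π ρ : Partition (suc m)) → Dec (Orbit π ρ)
orbit? {m} π ρ = map′
  (λ (k , e) → toℕ k , e)
  (λ (k , e) → let k%n<n = m%n<n k (suc m) in Fin.fromℕ< k%n<n , (begin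
    iterate rotate π (toℕ (Fin.fromℕ< k%n<n))    ≡⟨ cong (iterate rotate π) (toℕ-fromℕ< k%n<n) ⟩
    iterate rotate π (k % suc m)                 ≈⟨ reduce k ⟨
    iterate rotate π k                           ≈⟨ e ⟩
    ρ                                            ∎))
  (any? (λ k → iterate rotate π (toℕ k) ≟ₚ ρ))
  where
  open ≈ₚ-Reasoning

  reduce : ∀ k → iterate rotate π k ≈ₚ iterate rotate π (k % suc m)
  reduce k = let r = k % suc m ; q = k / suc m in begin
    iterate rotate π k                                 ≡⟨ cong (iterate rotate π) (m≡m%n+[m/n]*n k (suc m)) ⟩
    iterate rotate π (r + q * suc m)                   ≡⟨ iterate-+ rotate π r (q * suc m) ⟩
    iterate rotate (iterate rotate π r) (q * suc m)    ≈⟨ rotate-multiple q (iterate rotate π r) ⟩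
    iterate rotate π r                                 ∎

orbit-rotate : (π ρ : Partition n) → Orbit π ρ → Orbit (rotate π) (rotate ρ)
orbit-rotate π ρ (k , e) = k , (begin
  iterate rotate (rotate π) k    ≡⟨ iterate-comm rotate π k ⟩
  rotate (iterate rotate π k)    ≈⟨ rotate-cong (iterate rotate π k) ρ e ⟩
  rotate ρ                       ∎)
  where open ≈ₚ-Reasoning

iterate-kreweras : ∀ k (π : Partition n) → iterate rotate (kreweras π) k ≈ₚ kreweras (iterate rotate π k)
iterate-kreweras zero    π = λ _ → refl
iterate-kreweras (suc k) π = begin
  iterate rotate (rotate (kreweras π)) k    ≈⟨ iterate-cong k (kreweras-rotate π) ⟨
  iterate rotate (kreweras (rotate π)) k    ≈⟨ iterate-kreweras k (rotate π) ⟩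
  kreweras (iterate rotate (rotate π) k)    ∎
  where open ≈ₚ-Reasoning

orbit-kreweras : (π ρ : Partition n) → Orbit π ρ → Orbit (kreweras π) (kreweras ρ)
orbit-kreweras π ρ (k , e) = k , (begin
  iterate rotate (kreweras π) k    ≈⟨ iterate-kreweras k π ⟩
  kreweras (iterate rotate π k)    ≈⟨ kreweras-cong (iterate rotate π k) ρ e ⟩
  kreweras ρ                       ∎)
  where open ≈ₚ-Reasoning

singletons-iterate : ∀ k (π : Partition n) → singletons (iterate rotate π k) ≡ singletons π
singletons-iterate zero    π = refl
singletons-iterate (suc k) π = trans (singletons-iterate k (rotate π)) (singletons-rotate π)

adjacencies-iterate : ∀ k (π : Partition n) → adjacencies (iterate rotate π k) ≡ adjacencies π
adjacencies-iterate zero    π = refl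
adjacencies-iterate (suc k) π = trans (adjacencies-iterate k (rotate π)) (adjacencies-rotate π)

-- Finiteness

module _ (S : Setoid 0ℓ 0ℓ) where
  open Setoid S using (_≈_) renaming (sym to ≈-sym)

  lookup-injective : ∀ {xs} → AllPairs (λ x y → ¬ x ≈ y) xs →
                     ∀ i j → List.lookup xs i ≈ List.lookup xs j → i ≡ j
  lookup-injective (p ∷ ps) zero    zero    e = refl
  lookup-injective (p ∷ ps) zero    (suc j) e = contradiction e (All.lookup p (∈-lookup j))
  lookup-injective (p ∷ ps) (suc i) zero    e = contradiction (≈-sym e) (All.lookup p (∈-lookup i))
  lookup-injective (p ∷ ps) (suc i) (suc j) e = cong suc (lookup-injective ps i j e)

module _ (S : DecSetoid 0ℓ 0ℓ) where
  open DecSetoid S renaming (setoid to S₀; refl to ≈-refl; sym to ≈-sym; trans to ≈-trans)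

  -- Deduplication leaves exactly one listed representative of each class, so the position in the
  -- shortened list is the required bijection.
  enumerated⇒hasCardinality : ∀ {xs} → IsEnumeration S₀ xs → ∃[ N ] HasCardinality S₀ N
  enumerated⇒hasCardinality {xs} enum = List.length ys , record
    { to        = position
    ; from      = List.lookup ys
    ; to-cong   = position-cong
    ; from-cong = λ { refl → ≈-refl }
    ; inverse   = (λ {i} e → trans (position-cong e) (unique (≈-sym (at-position (List.lookup ys i)))))
                , (λ { {x} refl → ≈-sym (at-position x) })
    }
    where
    ys : List Carrier
    ys = deduplicate _≟_ xs

    enum′ : IsEnumeration S₀ ys
    enum′ = deduplicate⁺ S enum

    position : Carrier → Fin (List.length ys)
    position x = Any.index (enum′ x)

    at-position : ∀ x → x ≈ List.lookup ys (position x)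
    at-position x = lookup-index (enum′ x)

    unique : ∀ {i j} → List.lookup ys i ≈ List.lookup ys j → i ≡ j
    unique = lookup-injective S₀ (deduplicate-! S xs) _ _

    position-cong : ∀ {x y} → x ≈ y → position x ≡ position y
    position-cong {x} {y} e = unique
      (≈-trans (≈-sym (at-position x)) (≈-trans e (at-position y)))

module _ {A : Set} {P : A → Set} (P? : Decidable P) where

  restrict : List A → List (Σ A P)
  restrict []       = []
  restrict (x ∷ xs) with P? x
  ... | yes p = (x , p) ∷ restrict xs
  ... | no  _ = restrict xs

  -- The list may contain only an element equivalent to `x`, so `P` has to be transported along the
  -- equivalence before the filter keeps it.
  ∈-restrict : {_≈_ : A → A → Set} → (∀ x y → x ≈ y → P x → P y) →
               ∀ {x xs} → P x → Any (x ≈_) xs → Any ((x ≈_) ∘ proj₁) (restrict xs)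
  ∈-restrict resp {x} {y ∷ ys} p x∈ with P? y | x∈
  ... | yes _ | here e   = here e
  ... | yes _ | there x∈ = there (∈-restrict resp p x∈)
  ... | no ¬q | here e   = contradiction (resp x y e p) ¬q
  ... | no _  | there x∈ = ∈-restrict resp p x∈

module _ {n : ℕ} where

  -- The partition into the nonempty fibres of `f`. Every partition arises in this way, by sending
  -- each point to a chosen point of its block, so the functions from `Fin n` to itself reach all
  -- partitions.
  kernel : (Fin n → Fin n) → Partition n
  kernel f = fromEquivalence (On.isDecEquivalence f ≡-isDecEquivalence)

  module _ (π : Partition n) where
    open Partition π using (nonempty; cover; disjoint)

    blockLabel : Fin n → Fin n
    blockLabel i = proj₁ (nonempty (proj₁ (proj₂ (cover i))))

    sameBlock-label : ∀ i → SameBlock π i (blockLabel i)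
    sameBlock-label i = let (B , b , p) = cover i in B , b , p , proj₂ (nonempty b)

    blockLabel-cong : ∀ {i j} → SameBlock π i j → blockLabel i ≡ blockLabel j
    blockLabel-cong {i} {j} s = same (proj₁ (proj₂ (cover i))) (proj₁ (proj₂ (cover j)))
      (let (B , b , p) = cover i
           (C , c , q) = cover j
       in disjoint b c (block-closed π b p s) q)
      where
      -- The chosen point depends on the proof that the set is a block; any two such proofs are
      -- equal.
      same : ∀ {B C} (b : Block π B) (c : Block π C) → B ≡ C → proj₁ (nonempty b) ≡ proj₁ (nonempty c)
      same b c refl = cong (λ t → proj₁ (nonempty t)) (Bool.T-irrelevant b c)

    -- Stated for every `f` that agrees pointwise with the label, since decoding the numerical code
    -- of `blockLabel π` returns it pointwise.
    kernel-blockLabel : ∀ {f} → (∀ i → f i ≡ blockLabel i) → π ≈ₚ kernel f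
    kernel-blockLabel {f} h = ⊑-antisym π (kernel f)
      (λ {i} {j} s → from kernel⇔ (trans (h i) (trans (blockLabel-cong s) (sym (h j)))))
      (λ {i} {j} s → sameBlock-trans π (sameBlock-label i)
        (subst (λ k → SameBlock π k j) (trans (sym (h j)) (trans (sym (to kernel⇔ s)) (h i)))
          (sameBlock-sym π (sameBlock-label j))))
      where
      kernel⇔ : ∀ {i j} → SameBlock (kernel f) i j ⇔ f i ≡ f j
      kernel⇔ = sameBlock-fromEquivalence (On.isDecEquivalence f ≡-isDecEquivalence)

allPartitions : ∀ n → List (Partition n)
allPartitions n = List.tabulate {n = n ^ n} (λ t → kernel (finToFun t))

allPartitions-enumerates : IsEnumeration (partitions n) (allPartitions n)
allPartitions-enumerates π = tabulate⁺ (funToFin (blockLabel π))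
  (kernel-blockLabel π (finToFun-funToFin (blockLabel π)))

crossing? : (π : Partition n) → Dec (Crossing π)
crossing? π =
  any? λ a → any? λ b → any? λ c → any? λ d →
    a <? b ×-dec b <? c ×-dec c <? d ×-dec
    anySubset? λ B → anySubset? λ C →
      T? (isBlock π B) ×-dec T? (isBlock π C) ×-dec ¬? (≡-dec Bool._≟_ B C) ×-dec
      a ∈? B ×-dec c ∈? B ×-dec b ∈? C ×-dec d ∈? C

-- The complement as a bijection exchanging the statistics

kreweras-rotate-kreweras : (π : Partition n) → Noncrossing π → kreweras (rotate (kreweras π)) ≈ₚ π
kreweras-rotate-kreweras π nc = begin
  kreweras (rotate (kreweras π))    ≈⟨ kreweras-rotate (kreweras π) ⟩
  rotate (kreweras (kreweras π))    ≈⟨ rotate-kreweras² π nc ⟩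
  π                                 ∎
  where open ≈ₚ-Reasoning

singletons-kreweras-rotate : (π : Partition n) → Noncrossing π →
                             singletons (kreweras (rotate π)) ≡ adjacencies π
singletons-kreweras-rotate π nc = trans
  (singletons-cong (kreweras (rotate π)) (rotate (kreweras π)) (kreweras-rotate π))
  (trans (singletons-rotate (kreweras π)) (singletons-kreweras π nc))

adjacencies-kreweras-rotate : (π : Partition n) → Noncrossing π →
                              adjacencies (kreweras (rotate π)) ≡ singletons π
adjacencies-kreweras-rotate π nc = trans
  (adjacencies-cong (kreweras (rotate π)) (rotate (kreweras π)) (kreweras-rotate π))
  (trans (adjacencies-rotate (kreweras π)) (adjacencies-kreweras π nc))

NoncrossingWith : (ℕ → ℕ → Set) → Partition n → Set
NoncrossingWith P π = Noncrossing π × P (singletons π) (adjacencies π)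

module _ {_≈_ : Partition n → Partition n → Set}
         (≈-isDec : IsDecEquivalence _≈_)
         (≈ₚ⇒≈ : ∀ π ρ → π ≈ₚ ρ → π ≈ ρ)
         (≈-rotate : ∀ π ρ → π ≈ ρ → rotate π ≈ rotate ρ)
         (≈-kreweras : ∀ π ρ → π ≈ ρ → kreweras π ≈ kreweras ρ) where
  private
    module ≈ = IsDecEquivalence ≈-isDec

    class : (ℕ → ℕ → Set) → DecSetoid 0ℓ 0ℓ
    class P = On.decSetoid {B = Σ[ π ∈ Partition n ] NoncrossingWith P π}
      (record { isDecEquivalence = ≈-isDec }) proj₁

  -- The equivalence is any decidable one that is coarser than equality of partitions and preserved
  -- by rotation and complement, so one argument serves both partitions and rotation classes. The
  -- cardinality is found for `P` by enumeration and carried to `Q` by the complement.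
  noncrossing-sameNumber : (P Q : ℕ → ℕ → Set) → (∀ s a → Dec (P s a)) → (∀ {s a} → P s a ⇔ Q a s) →
    SameNumber (DecSetoid.setoid (class P)) (DecSetoid.setoid (class Q))
  noncrossing-sameNumber P Q P? P⇔Q =
    let (N , card) = enumerated⇒hasCardinality (class P) enum in N , card , inverse complement card
    where
    with? : Decidable (NoncrossingWith {n} P)
    with? π = ¬? (crossing? π) ×-dec P? (singletons π) (adjacencies π)

    with-cong : ∀ π ρ → π ≈ₚ ρ → NoncrossingWith {n} P π → NoncrossingWith P ρ
    with-cong π ρ e (nc , p) = noncrossing-cong π ρ e nc ,
      subst₂ P (singletons-cong π ρ e) (adjacencies-cong π ρ e) p

    enum : IsEnumeration (DecSetoid.setoid (class P))
             (restrict with? (allPartitions n))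
    -- The list is complete up to equality of partitions, hence also up to the coarser equivalence.
    enum (π , p) = Any.map (λ {(ρ , _)} → ≈ₚ⇒≈ π ρ)
      (∈-restrict with? {_≈ₚ_} with-cong {x = π} p (allPartitions-enumerates π))

    inverts : ∀ π → Noncrossing π → kreweras (rotate (kreweras π)) ≈ π
    inverts π nc = ≈ₚ⇒≈ _ π (kreweras-rotate-kreweras π nc)

    -- The inverse is kreweras ∘ rotate rather than rotate ∘ kreweras because every complement is
    -- noncrossing, so that rotate need not be shown to preserve this property.
    complement : Inverse (DecSetoid.setoid (class Q)) (DecSetoid.setoid (class P))
    complement = record
      { to        = λ (π , nc , q) → kreweras π , kreweras-noncrossing π ,
          subst₂ P (sym (singletons-kreweras π nc)) (sym (adjacencies-kreweras π nc)) (from P⇔Q q)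
      ; from      = λ (π , nc , p) → kreweras (rotate π) , kreweras-noncrossing (rotate π) ,
          subst₂ Q (sym (singletons-kreweras-rotate π nc)) (sym (adjacencies-kreweras-rotate π nc)) (to P⇔Q p)
      ; to-cong   = λ {x} {y} → ≈-kreweras (proj₁ x) (proj₁ y)
      ; from-cong = λ {x} {y} e → ≈-kreweras _ _ (≈-rotate (proj₁ x) (proj₁ y) e)
      ; inverse   =
          (λ {x} {y} e → let (π , nc , _) = x in
            ≈.trans (≈-kreweras (proj₁ y) (rotate (kreweras π))
                      (≈.trans e (≈ₚ⇒≈ (kreweras (rotate π)) (rotate (kreweras π)) (kreweras-rotate π))))
                    (inverts π nc))
        , (λ {x} {y} e → let (π , nc , _) = x in
            ≈.trans (≈-kreweras (rotate (proj₁ y)) (rotate (kreweras π)) (≈-rotate (proj₁ y) (kreweras π) e))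
                    (inverts π nc))
      }

-- The two instances: equality and rotation equivalence

≈ₚ-isDecEquivalence : IsDecEquivalence (_≈ₚ_ {n})
≈ₚ-isDecEquivalence {n} = record { isEquivalence = Setoid.isEquivalence (partitions n) ; _≟_ = _≟ₚ_ }

≈ᵣ-isDecEquivalence : ∀ {m} → IsDecEquivalence (_≈ᵣ_ {suc m})
≈ᵣ-isDecEquivalence {m} = record
  { isEquivalence = Setoid.isEquivalence (rotationClasses (suc m))
  ; _≟_ = λ π ρ → map′ (from (≈ᵣ⇔orbit π ρ)) (to (≈ᵣ⇔orbit π ρ)) (orbit? π ρ)
  }

module _ (P Q : ℕ → ℕ → Set) (P? : ∀ s a → Dec (P s a)) (P⇔Q : ∀ {s a} → P s a ⇔ Q a s) where

  partitions-sameNumber : SameNumber (NCPartitions n (λ π → P (singletons π) (adjacencies π)))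
                                     (NCPartitions n (λ π → Q (singletons π) (adjacencies π)))
  partitions-sameNumber {n} = noncrossing-sameNumber {n} {_≈ₚ_} ≈ₚ-isDecEquivalence (λ _ _ e → e)
    rotate-cong kreweras-cong P Q P? P⇔Q

  rotationClasses-sameNumber : ∀ {m} → let n = suc m in
    SameNumber (NCRotationClasses n (λ π → P (singletons π) (adjacencies π)))
               (NCRotationClasses n (λ π → Q (singletons π) (adjacencies π)))
  rotationClasses-sameNumber {m} = noncrossing-sameNumber {suc m} {_≈ᵣ_} ≈ᵣ-isDecEquivalence
    (λ π ρ e → from (≈ᵣ⇔orbit π ρ) (0 , e))
    (λ π ρ e → from (≈ᵣ⇔orbit (rotate π) (rotate ρ)) (orbit-rotate π ρ (to (≈ᵣ⇔orbit π ρ) e)))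
    (λ π ρ e → from (≈ᵣ⇔orbit (kreweras π) (kreweras ρ)) (orbit-kreweras π ρ (to (≈ᵣ⇔orbit π ρ) e)))
    P Q P? P⇔Q

mainTheorem2 : ∀ (n : ℕ) → n ≥ 1 →
    (∀ (p q : ℕ) →
    SameNumber (NCPartitions n (λ π → singletons π ≡ p × adjacencies π ≡ q))
    (NCPartitions n (λ π → singletons π ≡ q × adjacencies π ≡ p)))
    × (∀ (k : ℕ) →
    SameNumber (NCPartitions n (λ π → singletons π ≡ k))
    (NCPartitions n (λ π → adjacencies π ≡ k)))
    × (∀ (π ρ : Partition n) → Noncrossing π → Noncrossing ρ → π ≈ᵣ ρ →
    singletons π ≡ singletons ρ × adjacencies π ≡ adjacencies ρ)
    × (∀ (p q : ℕ) →
    SameNumber (NCRotationClasses n (λ π → singletons π ≡ p × adjacencies π ≡ q))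
    (NCRotationClasses n (λ π → singletons π ≡ q × adjacencies π ≡ p)))
    × (∀ (k : ℕ) →
    SameNumber (NCRotationClasses n (λ π → singletons π ≡ k))
    (NCRotationClasses n (λ π → adjacencies π ≡ k)))
mainTheorem2 (suc m) _ =
    (λ p q → partitions-sameNumber (joint p q) (joint q p) (joint? p q) joint⇔)
  , (λ k → partitions-sameNumber (λ s _ → s ≡ k) (λ _ a → a ≡ k) (λ s _ → s ℕ.≟ k) (mk⇔ id id))
  -- Equal classes make `ρ` a rotation of `π`, and both statistics are constant along rotations.
  , (λ π ρ _ _ e → let (k , f) = to (≈ᵣ⇔orbit π ρ) e in
        trans (sym (singletons-iterate k π)) (singletons-cong (iterate rotate π k) ρ f)
      , trans (sym (adjacencies-iterate k π)) (adjacencies-cong (iterate rotate π k) ρ f))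
  , (λ p q → rotationClasses-sameNumber (joint p q) (joint q p) (joint? p q) joint⇔)
  , (λ k → rotationClasses-sameNumber (λ s _ → s ≡ k) (λ _ a → a ≡ k) (λ s _ → s ℕ.≟ k) (mk⇔ id id))
  where
  joint : ℕ → ℕ → ℕ → ℕ → Set
  joint p q s a = s ≡ p × a ≡ q

  joint? : ∀ p q s a → Dec (joint p q s a)
  joint? p q s a = s ℕ.≟ p ×-dec a ℕ.≟ q

  joint⇔ : ∀ {p q s a : ℕ} → joint p q s a ⇔ joint q p a s
  joint⇔ = mk⇔ swap swap
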